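{- For an integer $s\ge 1$, the problem $\mathrm{DYCK}(s)$ is $\lceil\log s\rceil$-streaming reducible to $\mathrm{DYCK}(2)$ with space and time $O(\log s)$.
   Context: Logarithms are base $2$. For an integer $s\ge1$, $\mathrm{DYCK}(s)$ is the language of well-parenthesized words with $s$ types of parentheses: over the alphabet $\{a_1,\bar a_1,\ldots,a_s,\bar a_s\}$ it is the smallest language $L$ satisfying $L=\{\epsilon\}\cup\bigcup_{i=1}^s a_iL\bar a_iL$. $\mathrm{DYCK}(s)$ also denotes the problem of deciding whether a given word is in the language. Streaming reduction: let $\Sigma_1,\Sigma_2$ be alphabets. A problem $P_1$ (on words over $\Sigma_1$) is $f(n)$-streaming reducible to a problem $P_2$ (on words over $\Sigma_2$) with space $\sigma(n)$ and time $t(n)$ if for every input $x=x_1\ldots x_n\in\Sigma_1^n$ there exists $y=y_1y_2\ldots y_n$ with each $y_i\in\Sigma_2^{f(n)}$ such that: (1) $y_i$ can be computed deterministically from $x_i$ using space $\sigma(n)$ and time $t(n)$; (2) from a solution of $P_2$ with input $y$, a solution of $P_1$ with input $x$ can be computed with space $\sigma(n)$ and time $t(n)$.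
   Formalization: For s = 1 the block length is taken to be 1 instead of ⌈log 1⌉ = 0, since with empty blocks a well-parenthesized and an ill-parenthesized word would give the same empty instance; for every s ≥ 2 the block length is ⌈log s⌉ as stated. -}

module Defs where

open import Data.Bool.Base using (Bool; true; false)
open import Data.Digit using (Bit; 0b; 1b)
open import Data.Fin.Base using (Fin; zero; suc; inject≤; finToFun; funToFin; combine)
open import Data.Fin.Properties using (inject≤-injective; funToFin-finToFin)
open import Data.List.Base as List using (List; []; _∷_; _++_; [_]; length; fromMaybe)
open import Data.Maybe.Base as Maybe using (Maybe; just; nothing)
open import Data.Nat.Base
open import Data.Nat.Induction using (<-rec)
open import Data.Nat.Logarithm using (⌈log₂_⌉; ⌈log₂⌈n/2⌉⌉≡⌈log₂n⌉∸1)
open import Data.Nat.Properties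
open import Data.Product.Base using (_×_; _,_; ∃-syntax)
open import Data.Vec.Base as Vec using (Vec; []; _∷_; tabulate; lookup; toList)
open import Data.Vec.Properties using (∷-injective; lookup∘tabulate)
open import Function.Base using (_∘_)
open import Function.Definitions using (Injective)
open import Relation.Binary.PropositionalEquality
  using (_≡_; refl; cong; cong₂; module ≡-Reasoning)
open import Relation.Nullary.Reflects using (Reflects)

infix 4 _∈O_

_∈O_ : (ℕ → ℕ) → (ℕ → ℕ) → Set
f ∈O g = ∃[ c ] ∃[ n₀ ] (∀ n → n₀ ≤ n → f n ≤ c * g n)

-- Deterministic Turing machines with a two-way read-only input tape, one
-- work tape and a write-only output tape.

data Move : Set where
  left stay right : Move

record Tape (A : Set) : Set where
  constructor tape
  field
    before : List A  -- nearest cell first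
    head   : A
    after  : List A

open Tape

moveHead : {A : Set} → A → Move → Tape A → Tape A
moveHead b left  (tape []       x rs)       = tape [] b (x ∷ rs)
moveHead b left  (tape (l ∷ ls) x rs)       = tape ls l (x ∷ rs)
moveHead b stay  t                          = t
moveHead b right (tape ls       x [])       = tape (x ∷ ls) b []
moveHead b right (tape ls       x (r ∷ rs)) = tape (x ∷ ls) r rs

-- The number of cells visited so far, provided the tape started as a single
-- blank cell.
cells : {A : Set} → Tape A → ℕ
cells t = length (before t) + suc (length (after t))

record Instruction (Q A : Set) : Set where
  constructor instruction
  field
    nextState : Q
    moveInput : Move
    writeWork : A
    moveWork  : Move
    emit      : Maybe Bit

open Instruction

-- On the input tape `nothing` is the blank surrounding the input; on the work
-- tape `zero` is the blank.  A transition `nothing` means that the machine halts.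
record Machine : Set where
  field
    states  : ℕ
    symbols : ℕ
    start   : Fin states
    δ       : Fin states → Maybe Bit → Fin (suc symbols) →
              Maybe (Instruction (Fin states) (Fin (suc symbols)))

  record Config : Set where
    constructor config
    field
      state : Fin states
      input : Tape (Maybe Bit)
      work  : Tape (Fin (suc symbols))

  open Config

  inputTape : List Bit → Tape (Maybe Bit)
  inputTape []       = tape [] nothing []
  inputTape (b ∷ bs) = tape [] (just b) (List.map just bs)

  initial : List Bit → Config
  initial bs = config start (inputTape bs) (tape [] zero [])

  current : Config → Maybe (Instruction (Fin states) (Fin (suc symbols)))
  current c = δ (state c) (head (input c)) (head (work c))

  execute : Instruction (Fin states) (Fin (suc symbols)) → Config → Config
  execute i c = config
    (nextState i)
    (moveHead nothing (moveInput i) (input c))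
    (moveHead zero (moveWork i) (record (work c) { head = writeWork i }))

  -- Run S T c out: from c the machine halts after at most T steps, never uses
  -- more than S work cells, and emits out.
  data Run (S : ℕ) : ℕ → Config → List Bit → Set where
    halt : ∀ {T c} → cells (work c) ≤ S → current c ≡ nothing →
           Run S T c []
    next : ∀ {T c i out} → cells (work c) ≤ S → current c ≡ just i →
           Run S T (execute i c) out →
           Run S (suc T) c (fromMaybe (emit i) ++ out)

_maps_to_withinSpace_andTime_ : Machine → List Bit → List Bit → ℕ → ℕ → Set
M maps u to v withinSpace S andTime T = Machine.Run M S T (Machine.initial M u) v

-- Machines read and write letters through a fixed-width binary code.
record Alphabet : Set₁ where
  field
    Letter         : Set
    width          : ℕ
    code           : Letter → Vec Bit width
    code-injective : Injective _≡_ _≡_ code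

  encodeLetter : Letter → List Bit
  encodeLetter = toList ∘ code

  encodeWord : ∀ {n} → Vec Letter n → List Bit
  encodeWord = List.concatMap encodeLetter ∘ toList

record Problem : Set₁ where
  field
    alphabet : Alphabet

  open Alphabet alphabet public

  field
    Solution                 : Set
    encodeSolution           : Solution → List Bit
    encodeSolution-injective : Injective _≡_ _≡_ encodeSolution
    Solves                   : List Letter → Solution → Set

-- P₁ is f-streaming reducible to P₂ with space σ and time t, where E computes
-- each block from its letter and D computes a solution of P₁ from one of P₂.
-- E and D are arguments so that, for problems depending on a parameter, one
-- can demand the same machines for all values of the parameter: otherwise cost
-- could be hidden in the size of the machines.
StreamingReducibleVia : (E D : Machine) (f σ t : ℕ → ℕ) (P₁ P₂ : Problem) → Set
StreamingReducibleVia E D f σ t P₁ P₂ =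
  ∀ n (x : Vec P₁.Letter n) →
  ∃[ y ] ((∀ i → E maps P₁.encodeLetter (lookup x i)
                   to P₂.encodeWord (lookup {n = n} y i)
                   withinSpace σ n andTime t n)
        × (∀ v → P₂.Solves (toList (Vec.concat {m = f n} y)) v →
           ∃[ u ] (P₁.Solves (toList x) u
                 × D maps P₂.encodeSolution v to P₁.encodeSolution u
                     withinSpace σ n andTime t n)))
  where
  module P₁ = Problem P₁
  module P₂ = Problem P₂

data Paren (s : ℕ) : Set where
  opening closing : Fin s → Paren s

data Dyck {s : ℕ} : List (Paren s) → Set where
  ε    : Dyck []
  node : ∀ i {u v} → Dyck u → Dyck v → Dyck (opening i ∷ u ++ closing i ∷ v)

n≤2^⌈log₂n⌉ : ∀ n → n ≤ 2 ^ ⌈log₂ n ⌉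
n≤2^⌈log₂n⌉ = <-rec _ bound
  where
  open ≤-Reasoning
  bound : ∀ n → (∀ {m} → m < n → m ≤ 2 ^ ⌈log₂ m ⌉) → n ≤ 2 ^ ⌈log₂ n ⌉
  bound zero          rec = z≤n
  bound (suc zero)    rec = ≤-refl
  bound (suc (suc n)) rec = begin
    N                            ≡⟨ ⌊n/2⌋+⌈n/2⌉≡n N ⟨
    ⌊ N /2⌋ + ⌈ N /2⌉            ≤⟨ +-monoˡ-≤ ⌈ N /2⌉ (⌊n/2⌋≤⌈n/2⌉ N) ⟩
    ⌈ N /2⌉ + ⌈ N /2⌉            ≡⟨ cong (⌈ N /2⌉ +_) (+-identityʳ ⌈ N /2⌉) ⟨
    2 * ⌈ N /2⌉                  ≤⟨ *-monoʳ-≤ 2 (rec (⌈n/2⌉<n n)) ⟩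
    2 * 2 ^ ⌈log₂ ⌈ N /2⌉ ⌉      ≡⟨ cong (λ k → 2 * 2 ^ k) (⌈log₂⌈n/2⌉⌉≡⌈log₂n⌉∸1 N) ⟩
    2 ^ ⌈log₂ N ⌉                ∎
    where N = suc (suc n)

binary : ∀ {s} → Fin s → Vec Bit ⌈log₂ s ⌉
binary {s} i = tabulate (finToFun (inject≤ i (n≤2^⌈log₂n⌉ s)))

finToFun-injective : ∀ {m n} (i j : Fin (m ^ n)) →
                     (∀ k → finToFun {m} {n} i k ≡ finToFun j k) → i ≡ j
finToFun-injective {m} {n} i j eq = begin
  i                              ≡⟨ funToFin-finToFin {n} i ⟨
  funToFin (finToFun {m} {n} i)  ≡⟨ funToFin-cong eq ⟩
  funToFin (finToFun {m} {n} j)  ≡⟨ funToFin-finToFin {n} j ⟩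
  j                              ∎
  where
  open ≡-Reasoning
  funToFin-cong : ∀ {k l} {f g : Fin k → Fin l} → (∀ a → f a ≡ g a) →
                  funToFin f ≡ funToFin g
  funToFin-cong {zero}  p = refl
  funToFin-cong {suc k} p = cong₂ combine (p zero) (funToFin-cong (p ∘ suc))

binary-injective : ∀ {s} → Injective _≡_ _≡_ (binary {s})
binary-injective {s} {i} {j} eq =
  inject≤-injective le le i j (finToFun-injective {2} {⌈log₂ s ⌉} _ _ λ k → begin
    finToFun (inject≤ i le) k  ≡⟨ lookup∘tabulate (finToFun (inject≤ i le)) k ⟨
    lookup (binary i) k        ≡⟨ cong (λ w → lookup w k) eq ⟩
    lookup (binary j) k        ≡⟨ lookup∘tabulate (finToFun (inject≤ j le)) k ⟩
    finToFun (inject≤ j le) k  ∎)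
  where
  open ≡-Reasoning
  le = n≤2^⌈log₂n⌉ s

parenCode : ∀ {s} → Paren s → Vec Bit (suc ⌈log₂ s ⌉)
parenCode (opening i) = 0b ∷ binary i
parenCode (closing i) = 1b ∷ binary i

parenCode-injective : ∀ {s} → Injective _≡_ _≡_ (parenCode {s})
parenCode-injective {_} {opening i} {opening j} eq with ∷-injective eq
... | _ , eq′ = cong opening (binary-injective eq′)
parenCode-injective {_} {closing i} {closing j} eq with ∷-injective eq
... | _ , eq′ = cong closing (binary-injective eq′)
parenCode-injective {_} {opening i} {closing j} eq with ∷-injective eq
... | () , _
parenCode-injective {_} {closing i} {opening j} eq with ∷-injective eq
... | () , _

answerCode : Bool → List Bit
answerCode false = [ 0b ]
answerCode true  = [ 1b ]

answerCode-injective : Injective _≡_ _≡_ answerCode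
answerCode-injective {false} {false} eq = refl
answerCode-injective {true}  {true}  eq = refl

DYCK : ℕ → Problem
DYCK s = record
  { alphabet = record
    { Letter         = Paren s
    ; width          = suc ⌈log₂ s ⌉
    ; code           = parenCode
    ; code-injective = parenCode-injective
    }
  ; Solution                 = Bool
  ; encodeSolution           = answerCode
  ; encodeSolution-injective = answerCode-injective
  ; Solves                   = λ w → Reflects (Dyck w)
  }

{-# OPTIONS --safe #-}

-- Replace each type of parenthesis by its binary expansion, written with
-- opening parentheses in order and with closing ones in reverse order.  As all
-- expansions have the same positive length and are distinct, a stack automaton
-- accepts a word exactly when it accepts the encoded word.  A finite automaton
-- with a two-way input head computes the encoding of one letter in linear time,
-- without using its work tape.

module Submission where

open import Data.Bool.Base using (true; false)
open import Data.Digit using (Bit; 0b; 1b)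
open import Data.Fin.Base using (Fin; zero; suc)
open import Data.List.Base as List
  using (List; []; _∷_; _++_; _∷ʳ_; _ʳ++_; [_]; concatMap; length; reverse)
open import Data.List.Properties
  using (++-assoc; ++-identityʳ; concatMap-map; concatMap-cong; length-reverse; ʳ++-defn)
open import Data.Maybe.Base using (Maybe; just; nothing)
open import Data.Nat.Base using (ℕ; zero; suc; _+_; _*_; _≤_; s≤s; _⊔_; NonZero; nonZero)
open import Data.Nat.Logarithm using (⌈log₂_⌉; ⌈log₂⌉-mono-≤)
open import Data.Nat.Properties
  using ( ≤-refl; ≤-trans; ≤-reflexive; *-mono-≤; *-monoʳ-≤; +-monoˡ-≤; m≤m+n; m≤n+m
        ; *-identityˡ; *-comm; *-distribʳ-+; module ≤-Reasoning )
open import Data.Nat.Tactic.RingSolver using (solve-∀)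
open import Data.Product.Base using (_×_; _,_; ∃-syntax)
open import Data.Vec.Base as Vec using (Vec; []; _∷_; toList; lookup)
open import Data.Vec.Properties
  using (toList-map; toList-++; toList-reverse; length-toList; lookup-map; reverse-injective)
open import Function.Base using (_∘_)
open import Function.Bundles using (_⇔_; mk⇔; Equivalence)
open import Function.Definitions using (Injective)
open import Relation.Binary.PropositionalEquality
  using (_≡_; refl; sym; trans; cong; subst; module ≡-Reasoning)
open import Relation.Nullary.Negation using (¬_; contradiction)
open import Relation.Nullary.Reflects using (Reflects; ofʸ; ofⁿ)
open import Defs

private variable
  k l n s : ℕ

-- Stack automata

-- The list holds the types still open, innermost first. Unlike in `Dyck`, the first letter of the
-- word fixes the rule, so a run can be followed letter by letter.
data Closes {s : ℕ} : List (Fin s) → List (Paren s) → Set where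
  done : Closes [] []
  push : ∀ {i S w} → Closes (i ∷ S) w → Closes S (opening i ∷ w)
  pop  : ∀ {i S w} → Closes S w → Closes (i ∷ S) (closing i ∷ w)

-- The arbitrary stack and remainder make the induction go through: inside a `node`, the inner word
-- is read above the pushed `i`, with the matching `closing i` in the remainder.
Dyck-++-Closes : ∀ {u} {S : List (Fin s)} {w} → Dyck u → Closes S w → Closes S (u ++ w)
Dyck-++-Closes ε c = c
Dyck-++-Closes {S = S} {w} (node i {u} {v} du dv) c =
  subst (Closes S) (cong (opening i ∷_) (sym (++-assoc u (closing i ∷ v) w)))
    (push (Dyck-++-Closes du (pop (Dyck-++-Closes dv c))))

Dyck⇒Closes : ∀ {w : List (Paren s)} → Dyck w → Closes [] w
Dyck⇒Closes {w = w} d = subst (Closes []) (++-identityʳ w) (Dyck-++-Closes d done)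

-- The classical decomposition of a word that empties a stack: balanced words separated by the
-- closing parentheses that pop its entries. It generalizes `Dyck` to nonempty stacks, for the
-- induction behind `Closes⇒Dyck`.
data Factors {s : ℕ} : List (Fin s) → List (Paren s) → Set where
  last : ∀ {w} → Dyck w → Factors [] w
  more : ∀ {u i S w} → Dyck u → Factors S w → Factors (i ∷ S) (u ++ closing i ∷ w)

-- After a `push`, the first separator matches the parenthesis just opened, so it joins the first
-- two balanced words into one `node`; a `pop` contributes an empty balanced word.
Closes⇒Factors : ∀ {S : List (Fin s)} {w} → Closes S w → Factors S w
Closes⇒Factors done     = last ε
Closes⇒Factors (pop c)  = more ε (Closes⇒Factors c)
Closes⇒Factors (push {i} c) with Closes⇒Factors c
... | more du (last dv) = last (node i du dv)
... | more {u} du (more {u′} {j} {S} {w} du′ f) =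
  subst (Factors (j ∷ S)) (cong (opening i ∷_) (++-assoc u (closing i ∷ u′) (closing j ∷ w)))
    (more (node i du du′) f)

Closes⇒Dyck : ∀ {w : List (Paren s)} → Closes [] w → Dyck w
Closes⇒Dyck c with Closes⇒Factors c
... | last d = d

pushes⁺ : ∀ (d : Vec (Fin k) l) {S w} →
          Closes (toList (Vec.reverse d) ++ S) w → Closes S (toList (Vec.map opening d) ++ w)
pushes⁺ d {S} {w} c =
  -- `ʳ++` mirrors successive pushes definitionally, so `go` needs no rewriting; the passage from
  -- `reverse` is made once, here.
  go d (subst (λ T → Closes T w) (trans (cong (_++ S) (toList-reverse d)) (sym (ʳ++-defn (toList d)))) c)
  where
  go : ∀ {l} (d : Vec (Fin _) l) {S} → Closes (toList d ʳ++ S) w →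
       Closes S (toList (Vec.map opening d) ++ w)
  go []      c = c
  go (_ ∷ d) c = push (go d c)

pushes⁻ : ∀ (d : Vec (Fin k) l) {S w} →
          Closes S (toList (Vec.map opening d) ++ w) → Closes (toList (Vec.reverse d) ++ S) w
pushes⁻ d {S} {w} c =
  subst (λ T → Closes T w) (trans (ʳ++-defn (toList d)) (cong (_++ S) (sym (toList-reverse d)))) (go d c)
  where
  go : ∀ {l} (d : Vec (Fin _) l) {S} → Closes S (toList (Vec.map opening d) ++ w) →
       Closes (toList d ʳ++ S) w
  go []      c        = c
  go (_ ∷ d) (push c) = go d c

pops⁺ : ∀ (d : Vec (Fin k) l) {S w} →
        Closes S w → Closes (toList d ++ S) (toList (Vec.map closing d) ++ w)
pops⁺ []      c = c
pops⁺ (_ ∷ d) c = pop (pops⁺ d c)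

-- Popping compares the block with the top of the stack digit by digit; since `d` and `e` have equal
-- length, the comparison ends exactly at the block boundary.
pops⁻ : ∀ (d e : Vec (Fin k) l) {S w} →
        Closes (toList d ++ S) (toList (Vec.map closing e) ++ w) → d ≡ e × Closes S w
pops⁻ []      []      c       = refl , c
pops⁻ (_ ∷ d) (_ ∷ e) (pop c) with pops⁻ d e c
... | refl , c′ = refl , c′

-- Block codes

module Block (digits : Fin s → Vec (Fin k) l) where

  block : Paren s → Vec (Paren k) l
  block (opening i) = Vec.map opening (digits i)
  block (closing i) = Vec.map closing (Vec.reverse (digits i))

  blocks : List (Paren s) → List (Paren k)
  blocks = concatMap (toList ∘ block)

  -- The last digit opened lies on top, hence the reversal of each expansion.
  stack : List (Fin s) → List (Fin k)
  stack = concatMap (toList ∘ Vec.reverse ∘ digits)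

  Closes⇒Closes-blocks : ∀ {S w} → Closes S w → Closes (stack S) (blocks w)
  Closes⇒Closes-blocks done         = done
  Closes⇒Closes-blocks (push {i} c) = pushes⁺ (digits i) (Closes⇒Closes-blocks c)
  Closes⇒Closes-blocks (pop {i} c)  = pops⁺ (Vec.reverse (digits i)) (Closes⇒Closes-blocks c)

  module _ .{{_ : NonZero l}} (digits-injective : Injective _≡_ _≡_ digits) where

    ¬closes-nonempty-stack : ∀ {l} .{{_ : NonZero l}} (d : Vec (Fin k) l) {S} →
                             ¬ Closes (toList d ++ S) []
    ¬closes-nonempty-stack (_ ∷ _) ()

    ¬pops-empty-stack : ∀ {l} .{{_ : NonZero l}} (d : Vec (Fin k) l) {w} →
                        ¬ Closes [] (toList (Vec.map closing d) ++ w)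
    ¬pops-empty-stack (_ ∷ _) ()

    -- At block boundaries the stack always has the form `stack S`. Nonempty blocks exclude an empty
    -- word facing a nonempty stack and a closing letter facing an empty one; injectivity recovers
    -- the type from a matched expansion.
    Closes-blocks⇒Closes : ∀ S w → Closes (stack S) (blocks w) → Closes S w
    Closes-blocks⇒Closes []      []              c = done
    Closes-blocks⇒Closes (j ∷ S) []              c =
      contradiction c (¬closes-nonempty-stack (Vec.reverse (digits j)))
    Closes-blocks⇒Closes S       (opening i ∷ w) c =
      push (Closes-blocks⇒Closes (i ∷ S) w (pushes⁻ (digits i) c))
    Closes-blocks⇒Closes []      (closing i ∷ w) c =
      contradiction c (¬pops-empty-stack (Vec.reverse (digits i)))
    Closes-blocks⇒Closes (j ∷ S) (closing i ∷ w) c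
      with pops⁻ (Vec.reverse (digits j)) (Vec.reverse (digits i)) c
    ... | eq , c′ with digits-injective (reverse-injective eq)
    ...   | refl = pop (Closes-blocks⇒Closes S w c′)

    Dyck-blocks : ∀ {w} → Dyck (blocks w) ⇔ Dyck w
    Dyck-blocks {w} = mk⇔
      (Closes⇒Dyck ∘ Closes-blocks⇒Closes [] w ∘ Dyck⇒Closes)
      (Closes⇒Dyck ∘ Closes⇒Closes-blocks ∘ Dyck⇒Closes)

  toList-concat-block : ∀ (x : Vec (Paren s) n) →
                        toList (Vec.concat (Vec.map block x)) ≡ blocks (toList x)
  toList-concat-block []      = refl
  toList-concat-block (p ∷ x) =
    trans (toList-++ (block p) _) (cong (toList (block p) ++_) (toList-concat-block x))

-- The empty expansion of the only type for s = 1 is replaced by a single zero.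
pad : Vec Bit l → Vec Bit (1 ⊔ l)
pad []         = 0b ∷ []
pad v@(_ ∷ _)  = v

1⊔l-nonZero : ∀ l → NonZero (1 ⊔ l)
1⊔l-nonZero zero    = nonZero
1⊔l-nonZero (suc _) = nonZero

pad-injective : Injective _≡_ _≡_ (pad {l})
pad-injective {x = []}    {[]}    eq = refl
pad-injective {x = _ ∷ _} {_ ∷ _} eq = eq

-- Machines

Run-mono : ∀ {M S T T′ c out} → T ≤ T′ → Machine.Run M S T c out → Machine.Run M S T′ c out
Run-mono T≤T′       (Machine.halt fits stop)     = Machine.halt fits stop
Run-mono (s≤s T≤T′) (Machine.next fits step run) = Machine.next fits step (Run-mono T≤T′ run)

step : Fin n → Move → Maybe Bit → Maybe (Instruction (Fin n) (Fin 1))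
step q m e = just (instruction q m zero stay e)

blank : Tape (Fin 1)
blank = tape [] zero []

-- Encoding preserves and reflects membership, so the answer is merely copied.
copyMachine : Machine
copyMachine = record { states = 1 ; symbols = 0 ; start = zero ; δ = δ }
  where
  δ : Fin 1 → Maybe Bit → Fin 1 → Maybe (Instruction (Fin 1) (Fin 1))
  δ _ (just b) _ = step zero right (just b)
  δ _ nothing  _ = nothing

copyMachine-correct : ∀ v → copyMachine maps answerCode v to answerCode v withinSpace 1 andTime suc n
copyMachine-correct false = Machine.next ≤-refl refl (Machine.halt ≤-refl refl)
copyMachine-correct true  = Machine.next ≤-refl refl (Machine.halt ≤-refl refl)

module Encoder where

  pattern start     = zero
  pattern open₀     = suc start
  pattern openMark  = suc open₀
  pattern openBit   = suc openMark
  pattern padBit    = suc openBit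
  pattern close₀    = suc padBit
  pattern seekEnd   = suc close₀
  pattern retreat   = suc seekEnd
  pattern closeMark = suc retreat
  pattern closeBit  = suc closeMark

  -- Going backwards, the flag at the left end must not be copied; it is
  -- recognized by the blank beyond it, so `retreat` first looks one cell ahead.
  δ : Fin 10 → Maybe Bit → Fin 1 → Maybe (Instruction (Fin 10) (Fin 1))
  δ start     (just zero)       _ = step open₀     right nothing
  δ start     (just (suc zero)) _ = step close₀    right nothing
  δ open₀     nothing           _ = step padBit    stay  (just 0b)
  δ open₀     (just _)          _ = step openMark  stay  nothing
  δ openMark  (just _)          _ = step openBit   stay  (just 0b)
  δ openBit   (just b)          _ = step openMark  right (just b)
  δ padBit    _                 _ = step openMark  stay  (just 0b)
  δ close₀    nothing           _ = step padBit    stay  (just 1b)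
  δ close₀    (just _)          _ = step seekEnd   stay  nothing
  δ seekEnd   (just _)          _ = step seekEnd   right nothing
  δ seekEnd   nothing           _ = step retreat   left  nothing
  δ retreat   _                 _ = step closeMark left  nothing
  δ closeMark (just _)          _ = step closeBit  right (just 1b)
  δ closeBit  (just b)          _ = step retreat   left  (just b)
  δ _         _                 _ = nothing

  machine : Machine
  machine = record { states = 10 ; symbols = 0 ; start = start ; δ = δ }

  open Machine machine using (Run; halt; next; config)

  -- `tapeBefore` has the head on the first bit right of a cut in the input, `tapeAfter` on the
  -- first bit left of it; if there is none, on the blank. Left parts are listed nearest bit first.
  tapeBefore : List Bit → List Bit → Tape (Maybe Bit)
  tapeBefore ls []       = tape (List.map just ls) nothing []
  tapeBefore ls (b ∷ bs) = tape (List.map just ls) (just b) (List.map just bs)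

  tapeAfter : List Bit → List (Maybe Bit) → Tape (Maybe Bit)
  tapeAfter []       rs = tape [] nothing rs
  tapeAfter (b ∷ bs) rs = tape (List.map just bs) (just b) rs

  -- In the code of `DYCK 2` a parenthesis is its flag followed by one digit, so this is the code of
  -- a whole block.
  marked : Bit → List Bit → List Bit
  marked m = concatMap (λ b → m ∷ b ∷ [])

  openMark-run : ∀ ls bs → Run 1 (length bs * 2) (config openMark (tapeBefore ls bs) blank) (marked 0b bs)
  openMark-run ls []               = halt ≤-refl refl
  -- The tail is split only to let `moveHead` compute.
  openMark-run ls (b ∷ bs@[])      = next ≤-refl refl (next ≤-refl refl (openMark-run (b ∷ ls) bs))
  openMark-run ls (b ∷ bs@(_ ∷ _)) = next ≤-refl refl (next ≤-refl refl (openMark-run (b ∷ ls) bs))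

  -- Read leftwards from the head, the tape shows `bs` and then the flag `f`. Each bit takes three
  -- steps: look left, return while writing the mark, copy the bit and move left. At `f` the look
  -- left meets the blank and the machine halts.
  retreat-run : ∀ f bs rs → Run 1 (length bs * 3 + 2) (config retreat (tapeAfter (bs ∷ʳ f) rs) blank) (marked 1b bs)
  retreat-run f []               rs = next ≤-refl refl (halt ≤-refl refl)
  retreat-run f (b ∷ bs@[])      rs =
    next ≤-refl refl (next ≤-refl refl (next ≤-refl refl (retreat-run f bs (just b ∷ rs))))
  retreat-run f (b ∷ bs@(_ ∷ _)) rs =
    next ≤-refl refl (next ≤-refl refl (next ≤-refl refl (retreat-run f bs (just b ∷ rs))))

  -- The bits passed pile up on the left, nearest first, hence `ʳ++`; `[ nothing ]` is the blank
  -- visited to detect the end. As the left part is nonempty, turning back lands on a bit.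
  seekEnd-run : ∀ {T out} l ls bs →
                Run 1 T (config retreat (tapeAfter (bs ʳ++ (l ∷ ls)) [ nothing ]) blank) out →
                Run 1 (length bs + suc T) (config seekEnd (tapeBefore (l ∷ ls) bs) blank) out
  seekEnd-run l ls []               run = next ≤-refl refl run
  seekEnd-run l ls (b ∷ bs@[])      run = next ≤-refl refl (seekEnd-run b (l ∷ ls) bs run)
  seekEnd-run l ls (b ∷ bs@(_ ∷ _)) run = next ≤-refl refl (seekEnd-run b (l ∷ ls) bs run)

  open-run : ∀ (v : Vec Bit l) → machine maps 0b ∷ toList v to marked 0b (toList (pad v))
                                 withinSpace 1 andTime (5 + l * 4)
  -- Without digits, the blank next to the flag leads to `padBit`, which writes the padding zero;
  -- `openMark` then halts on the blank.
  open-run []          =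
    next ≤-refl refl (next ≤-refl refl (next ≤-refl refl (halt ≤-refl refl)))
  open-run v@(b ∷ v′) =
    next ≤-refl refl (next ≤-refl refl (Run-mono bound (openMark-run [ 0b ] (toList v))))
    where
    bound : length (toList v) * 2 ≤ 3 + Vec.length v * 4
    bound = ≤-trans (*-mono-≤ (≤-reflexive (length-toList v)) (m≤m+n 2 2)) (m≤n+m _ 3)

  close-run : ∀ (v : Vec Bit l) → machine maps 1b ∷ toList v to marked 1b (reverse (toList (pad v)))
                                  withinSpace 1 andTime (5 + l * 4)
  close-run []          =
    next ≤-refl refl (next ≤-refl refl (next ≤-refl refl (halt ≤-refl refl)))
  close-run v@(_ ∷ _) =
    next ≤-refl refl (next ≤-refl refl (Run-mono bound (seekEnd-run 1b [] bs run)))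
    where
    bs = toList v
    run : Run 1 (length (reverse bs) * 3 + 2)
              (config retreat (tapeAfter (bs ʳ++ [ 1b ]) [ nothing ]) blank) (marked 1b (reverse bs))
    run rewrite ʳ++-defn bs {[ 1b ]} = retreat-run 1b (reverse bs) [ nothing ]
    -- Two steps are already spent on the flag and the test for digits. The way to the right end
    -- takes one step per digit and one to turn; the way back is allotted three per digit plus two.
    bound : length bs + suc (length (reverse bs) * 3 + 2) ≤ 3 + Vec.length v * 4
    bound = ≤-reflexive (begin
      length bs + suc (length (reverse bs) * 3 + 2)  ≡⟨ cong (λ n → length bs + suc (n * 3 + 2)) (length-reverse bs) ⟩
      length bs + suc (length bs * 3 + 2)            ≡⟨ collect (length bs) ⟩
      3 + length bs * 4                              ≡⟨ cong (λ n → 3 + n * 4) (length-toList v) ⟩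
      3 + Vec.length v * 4                           ∎)
      where
      open ≡-Reasoning
      collect : ∀ n → n + suc (n * 3 + 2) ≡ 3 + n * 4
      collect = solve-∀

-- The reduction of `DYCK s` to `DYCK 2`

module _ (s : ℕ) where
  open Block (pad ∘ binary {s}) public

-- As `⌈log₂ 2 ⌉` is one, the binary expansion of a digit is the digit itself, by evaluation at each
-- value.
encodeLetter-opening : ∀ b → Problem.encodeLetter (DYCK 2) (opening b) ≡ 0b ∷ b ∷ []
encodeLetter-opening zero       = refl
encodeLetter-opening (suc zero) = refl

encodeLetter-closing : ∀ b → Problem.encodeLetter (DYCK 2) (closing b) ≡ 1b ∷ b ∷ []
encodeLetter-closing zero       = refl
encodeLetter-closing (suc zero) = refl

encodeWord-map : ∀ {f : Bit → Paren 2} {m} →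
                 (∀ b → Problem.encodeLetter (DYCK 2) (f b) ≡ m ∷ b ∷ []) →
                 ∀ (v : Vec Bit l) →
                 Problem.encodeWord (DYCK 2) (Vec.map f v) ≡ Encoder.marked m (toList v)
encodeWord-map {f = f} {m} eq v = begin
  concatMap encodeLetter (toList (Vec.map f v))   ≡⟨ cong (concatMap encodeLetter) (toList-map f v) ⟩
  concatMap encodeLetter (List.map f (toList v))  ≡⟨ concatMap-map encodeLetter f (toList v) ⟩
  concatMap (encodeLetter ∘ f) (toList v)         ≡⟨ concatMap-cong eq (toList v) ⟩
  Encoder.marked m (toList v)                     ∎
  where
  open ≡-Reasoning
  open Problem (DYCK 2) using (encodeLetter)

encoder-correct : ∀ (p : Paren s) →
  Encoder.machine maps Problem.encodeLetter (DYCK s) p to Problem.encodeWord (DYCK 2) (block s p)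
    withinSpace 1 andTime (5 + ⌈log₂ s ⌉ * 4)
encoder-correct {s} (opening i) =
  subst (λ out → Encoder.machine maps 0b ∷ toList v to out withinSpace 1 andTime (5 + ⌈log₂ s ⌉ * 4))
    (sym (encodeWord-map encodeLetter-opening (pad v)))
    (Encoder.open-run v)
  where v = binary i
encoder-correct {s} (closing i) =
  subst (λ out → Encoder.machine maps 1b ∷ toList v to out withinSpace 1 andTime (5 + ⌈log₂ s ⌉ * 4))
    (sym (trans (encodeWord-map encodeLetter-closing (Vec.reverse (pad v)))
                (cong (Encoder.marked 1b) (toList-reverse (pad v)))))
    (Encoder.close-run v)
  where v = binary i

Reflects-map : ∀ {A B : Set} {v} → A ⇔ B → Reflects A v → Reflects B v
Reflects-map A⇔B (ofʸ a)  = ofʸ (Equivalence.to A⇔B a)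
Reflects-map A⇔B (ofⁿ ¬a) = ofⁿ (¬a ∘ Equivalence.from A⇔B)

1≤⌈log₂n⌉ : 2 ≤ n → 1 ≤ ⌈log₂ n ⌉
1≤⌈log₂n⌉ = ⌈log₂⌉-mono-≤

proposition1 : ∃[ E ] ∃[ D ] ∃[ σ ] ∃[ t ] (σ ∈O ⌈log₂_⌉ × t ∈O ⌈log₂_⌉ ×
    (∀ (s : ℕ) → 1 ≤ s →
    StreamingReducibleVia E D (λ _ → 1 ⊔ ⌈log₂ s ⌉) (λ _ → σ s) (λ _ → t s) (DYCK s) (DYCK 2)))
proposition1 =
  Encoder.machine , copyMachine , (λ _ → 1) , (λ s → 5 + ⌈log₂ s ⌉ * 4) ,
  -- At `s` equal to 1 the logarithm is zero but the costs are positive, so both bounds start at 2.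
  -- In the second, the additive 5 is absorbed into `5 * m`, whence 9 as 5 + 4.
  (1 , 2 , λ n 2≤n → ≤-trans (1≤⌈log₂n⌉ 2≤n) (≤-reflexive (sym (*-identityˡ _)))) ,
  (9 , 2 , λ n 2≤n → linear (1≤⌈log₂n⌉ 2≤n)) ,
  λ s _ n x → Vec.map (block s) x ,
    (λ i → subst (λ ps → Encoder.machine maps Problem.encodeLetter (DYCK s) (lookup x i)
                           to Problem.encodeWord (DYCK 2) ps withinSpace 1 andTime (5 + ⌈log₂ s ⌉ * 4))
             (sym (lookup-map i (block s) x)) (encoder-correct (lookup x i))) ,
    λ v solves → v ,
      Reflects-map (Dyck-blocks s {{1⊔l-nonZero ⌈log₂ s ⌉}} (binary-injective ∘ pad-injective))
        (subst (λ w → Reflects (Dyck w) v) (toList-concat-block s x) solves) ,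
      copyMachine-correct v
  where
  linear : ∀ {m} → 1 ≤ m → 5 + m * 4 ≤ 9 * m
  linear {m} 1≤m = begin
    5 + m * 4      ≤⟨ +-monoˡ-≤ (m * 4) (*-monoʳ-≤ 5 1≤m) ⟩
    5 * m + m * 4  ≡⟨ cong (5 * m +_) (*-comm m 4) ⟩
    5 * m + 4 * m  ≡⟨ *-distribʳ-+ m 5 4 ⟨
    9 * m          ∎
    where open ≤-Reasoning
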